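{- Let $\varphi$ be a formula of the language $\mathcal{L}$. Then $\varphi$ is satisfiable relative to the class $\mathbf{MCM}$ of multi-classifier models if and only if $\varphi$ is satisfiable relative to the class $\mathbf{MDM}$ of multi-decision models.
   Context: Let $\mathit{Atm}_0$ be a countable (finite or infinite) set of atomic propositions (input variables) and $\mathit{Val}$ a finite set of output values. For each $x\in\mathit{Val}$ there is a decision atom $\mathsf{t}(x)$; $\mathit{Dec}=\{\mathsf{t}(x): x\in\mathit{Val}\}$ and $\mathit{Atm}=\mathit{Atm}_0\cup\mathit{Dec}$. The language $\mathcal{L}$ is given by $\varphi ::= p \mid \mathsf{t}(x)\mid \neg\varphi\mid \varphi\wedge\varphi\mid \Box_{\mathtt{I}}\varphi\mid \Box_{\mathtt{F}}\varphi$ with $p\in\mathit{Atm}_0$, $x\in\mathit{Val}$. A multi-classifier model (MCM) is a pair $\Gamma=(S,\Phi)$ with $S\subseteq 2^{\mathit{Atm}_0}$ and $\Phi$ a set of functions from $S$ to $\mathit{Val}$. For $s\in S$, $f\in\Phi$: $(\Gamma,s,f)\models p$ iff $p\in s$; $(\Gamma,s,f)\models\mathsf{t}(x)$ iff $f(s)=x$; Boolean connectives as usual; $(\Gamma,s,f)\models\Box_{\mathtt{I}}\varphi$ iff $(\Gamma,s',f)\models\varphi$ for all $s'\in S$; $(\Gamma,s,f)\models\Box_{\mathtt{F}}\varphi$ iff $(\Gamma,s,f')\models\varphi$ for all $f'\in\Phi$. $\varphi$ is satisfiable relative to $\mathbf{MCM}$ if $(\Gamma,s,f)\models\varphi$ for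 some MCM $\Gamma=(S,\Phi)$, $s\in S$, $f\in\Phi$. A multi-decision model (MDM) is a tuple $M=(W,\sim_{\Box_{\mathtt{I}}},\sim_{\Box_{\mathtt{F}}},V)$ with $W$ a set of worlds, $\sim_{\Box_{\mathtt{I}}},\sim_{\Box_{\mathtt{F}}}$ equivalence relations on $W$, and $V:W\to 2^{\mathit{Atm}}$, writing $V_Y(w)=V(w)\cap Y$, such that for all $w,v\in W$, $x,y\in\mathit{Val}$: (C1) $\sim_{\Box_{\mathtt{I}}}\circ\sim_{\Box_{\mathtt{F}}}=\sim_{\Box_{\mathtt{F}}}\circ\sim_{\Box_{\mathtt{I}}}$; (C2) if $V_{\mathit{Atm}_0}(w)=V_{\mathit{Atm}_0}(v)$ and $w\sim_{\Box_{\mathtt{I}}}v$ then $V_{\mathit{Dec}}(w)=V_{\mathit{Dec}}(v)$; (C3) if $w\sim_{\Box_{\mathtt{F}}}v$ then $V_{\mathit{Atm}_0}(w)=V_{\mathit{Atm}_0}(v)$; (C4) if $\mathsf{t}(x)\in V(w)$ and $x\neq y$ then $\mathsf{t}(y)\notin V(w)$; (C5) there is $x\in\mathit{Val}$ with $\mathsf{t}(x)\in V(w)$. Truth at $(M,w)$: atoms $q\in\mathit{Atm}$ are true iff $q\in V(w)$; Boolean connectives as usual; $\Box_{\mathtt{I}}\varphi$ (resp. $\Box_{\mathtt{F}}\varphi$) is true iff $\varphi$ is true at every $v$ with $w\sim_{\Box_{\mathtt{I}}}v$ (resp. $w\sim_{\Box_{\mathtt{F}}}v$). Satisfiability relative to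 $\mathbf{MDM}$ is defined in the usual way. -}

module Defs where

open import Data.Nat using (ℕ)
open import Data.Fin using (Fin)
open import Data.Bool using (Bool; true; false)
open import Data.Sum using (_⊎_; inj₁; inj₂)
open import Data.Product using (Σ; ∃; ∃-syntax; _×_; _,_)
open import Data.Empty using (⊥)
open import Relation.Nullary using (¬_)
open import Relation.Binary.PropositionalEquality using (_≡_; _≢_)
open import Relation.Binary.Structures using (IsEquivalence)
open import Level using (Level) renaming (suc to lsuc; zero to lzero)

-- Atm₀ is a type A (countability is imposed in the statement);
-- Val is the finite set Fin k;  t(x) for x : Fin k is a decision atom.
-- Atm = Atm₀ ∪ Dec is represented as A ⊎ Fin k.

data Form (A : Set) (k : ℕ) : Set where
  atom : A → Form A k
  t    : Fin k → Form A k
  ¬'   : Form A k → Form A k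
  _∧'_ : Form A k → Form A k → Form A k
  □I   : Form A k → Form A k
  □F   : Form A k → Form A k

-- Multi-classifier models.
-- S ⊆ 2^{Atm₀} is given as an index type St together with an injective
-- (up to extensional equality of subsets) map st : St → (A → Bool);
-- Φ is an index type Fn together with cl : Fn → St → Fin k, injective up
-- to extensional equality of functions (so Φ is a *set* of functions S → Val).

record MCM (A : Set) (k : ℕ) : Set₁ where
  field
    St  : Set
    st  : St → (A → Bool)
    st-inj : ∀ s s' → (∀ p → st s p ≡ st s' p) → s ≡ s'
    Fn  : Set
    cl  : Fn → St → Fin k
    cl-inj : ∀ f f' → (∀ s → cl f s ≡ cl f' s) → f ≡ f'

module _ {A : Set} {k : ℕ} (Γ : MCM A k) where
  open MCM Γ
  ⊨C : St → Fn → Form A k → Set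
  ⊨C s f (atom p) = st s p ≡ true
  ⊨C s f (t x) = cl f s ≡ x
  ⊨C s f (¬' φ) = ¬ (⊨C s f φ)
  ⊨C s f (φ ∧' ψ) = (⊨C s f φ) × (⊨C s f ψ)
  ⊨C s f (□I φ) = ∀ s' → ⊨C s' f φ
  ⊨C s f (□F φ) = ∀ f' → ⊨C s f' φ

SatMCM : {A : Set} {k : ℕ} → Form A k → Set₁
SatMCM {A} {k} φ =
  Σ (MCM A k) λ Γ → Σ (MCM.St Γ) λ s → Σ (MCM.Fn Γ) λ f → ⊨C Γ s f φ

_∘R_ : {W : Set} → (W → W → Set) → (W → W → Set) → (W → W → Set)
(R ∘R Q) w v = ∃[ u ] (R w u × Q u v)

record MDM (A : Set) (k : ℕ) : Set₁ where
  field
    W    : Set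
    _~I_ : W → W → Set
    _~F_ : W → W → Set
    V    : W → (A ⊎ Fin k) → Bool
    ~I-equiv : IsEquivalence _~I_
    ~F-equiv : IsEquivalence _~F_
    C1 : ∀ w v → ((_~I_ ∘R _~F_) w v → (_~F_ ∘R _~I_) w v)
               × ((_~F_ ∘R _~I_) w v → (_~I_ ∘R _~F_) w v)
    C2 : ∀ w v → (∀ p → V w (inj₁ p) ≡ V v (inj₁ p)) → w ~I v →
         ∀ x → V w (inj₂ x) ≡ V v (inj₂ x)
    C3 : ∀ w v → w ~F v → ∀ p → V w (inj₁ p) ≡ V v (inj₁ p)
    C4 : ∀ w (x y : Fin k) → V w (inj₂ x) ≡ true → x ≢ y → V w (inj₂ y) ≡ false
    C5 : ∀ w → ∃[ x ] (V w (inj₂ x) ≡ true)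

module _ {A : Set} {k : ℕ} (M : MDM A k) where
  open MDM M
  ⊨D : W → Form A k → Set
  ⊨D w (atom p) = V w (inj₁ p) ≡ true
  ⊨D w (t x) = V w (inj₂ x) ≡ true
  ⊨D w (¬' φ) = ¬ (⊨D w φ)
  ⊨D w (φ ∧' ψ) = (⊨D w φ) × (⊨D w ψ)
  ⊨D w (□I φ) = ∀ v → w ~I v → ⊨D v φ
  ⊨D w (□F φ) = ∀ v → w ~F v → ⊨D v φ

SatMDM : {A : Set} {k : ℕ} → Form A k → Set₁
SatMDM {A} {k} φ = Σ (MDM A k) λ M → Σ (MDM.W M) λ w → ⊨D M w φ

{-# OPTIONS --safe #-}
module Submission where

-- From a multi-classifier model, take the worlds to be the pairs (s, f).
-- Conversely, a multi-decision model would classically be turned into a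
-- multi-classifier model by reading off, for every ~I-class, the function from
-- valuations to decisions that it induces.  Without quotients and function
-- extensionality an infinite such model has no canonical representation, so
-- one passes to finite grids of states and classifiers.
--
-- Filtration: a description of a world consists of a column part (its label,
-- the □F-formulas true there), a row part (the □I-formulas true there) and its
-- decision.  States and classifiers are both two copies of the realised
-- descriptions.  The cell in state (b , δ) and row (b' , δ') holds δ if b = b'
-- and δ' otherwise, provided that this has the column part of δ and the row
-- part of δ'; if not, it holds some description with these two parts, which
-- exists by C1.  So every row and every column meets all descriptions it should.
--
-- Distinct states need distinct valuations, possibly by means of atoms which do
-- not occur in φ, and their number is not decidable.  Whether a grid using r
-- such atoms satisfies φ is decidable, and for large r it holds since states
-- can be tagged.  Take the least such r.  Then A cannot fail to have r atoms
-- outside φ: otherwise these atoms number r' < r, labels are full valuations,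
-- so by C2 every ~I-class induces a function from labels to decisions, and
-- filtration with this function in the row part uses only r' atoms.  Truth is
-- ¬¬-stable, so this ¬¬-existence suffices when it is stored irrelevantly.

open import Defs
open import Data.Bool using (Bool; true; false; _xor_; not)
import Data.Bool.Properties as Bool
open import Data.Empty using (⊥-elim)
open import Data.Fin using (Fin; zero; suc)
import Data.Fin.Properties as Fin
open import Data.List using (List; []; _∷_; _++_; length; allFin; deduplicate; cartesianProduct; cartesianProductWith)
import Data.List as List
import Data.List.Properties as List
open import Data.List.Membership.Propositional using (_∈_; _∉_; find; lose)
open import Data.List.Membership.Propositional.Properties
  using (∈-allFin; ∈-cartesianProduct⁺; ∈-cartesianProductWith⁺; ∈-lookup; ∈-++⁺ˡ; ∈-++⁺ʳ; ∈-deduplicate⁺)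
open import Data.List.Relation.Unary.All as All using (All; []; _∷_)
open import Data.List.Relation.Unary.Any as Any using (here; there; index)
open import Data.List.Relation.Unary.Any.Properties using (lookup-index)
open import Data.List.Relation.Unary.Unique.Propositional using (Unique; _∷_)
open import Data.List.Relation.Unary.Unique.DecPropositional.Properties using (deduplicate-!)
open import Data.Nat using (ℕ; zero; suc; _≤_; _<_; z≤n; s≤s)
open import Data.Nat.Induction using (<-wellFounded)
open import Data.Nat.Properties using (≮⇒≥; ≤-antisym; anyUpTo?)
open import Data.Product using (Σ; ∃; ∃-syntax; _×_; _,_; proj₁; proj₂; map₂)
import Data.Product.Properties as Product
open import Data.Sum using (_⊎_; inj₁; inj₂; [_,_])
open import Data.Unit using (⊤; tt)
open import Data.Vec using (Vec; []; _∷_; lookup; tabulate; zipWith)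
import Data.Vec as Vec
import Data.Vec.Properties as Vec
open import Data.Vec.Relation.Binary.Pointwise.Extensional using (ext; Pointwise-≡⇒≡)
open import Function.Base using (_∘_; id)
open import Function.Bundles using (_↣_; _⇔_; mk⇔; module Equivalence; module Injection)
open import Induction.WellFounded using (Acc; acc)
open import Relation.Binary.Definitions using (DecidableEquality)
open import Relation.Binary.Structures using (IsEquivalence)
open import Relation.Binary.PropositionalEquality
  using (_≡_; refl; sym; trans; cong; cong₂; subst)
open import Relation.Nullary using (¬_; Dec; yes; no; does)
open import Relation.Nullary.Decidable
  using (¬¬-excluded-middle; decidable-stable; recompute; map′; ¬?; _×-dec_; _⊎-dec_; _→-dec_; dec-true; dec-false)
open import Relation.Unary using (Decidable)

open Equivalence using (to; from)

-- Double negation, finite types and tables.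

private
  variable
    X Y : Set

infixl 1 _>>=_

_>>=_ : ¬ ¬ X → (X → ¬ ¬ Y) → ¬ ¬ Y
(m >>= f) ¬y = m λ x → f x ¬y

return : X → ¬ ¬ X
return x ¬x = ¬x x

record Finite (X : Set) : Set where
  field
    elements : List X
    complete : ∀ x → x ∈ elements

open Finite

any-finite? : Finite X → {P : X → Set} → Decidable P → Dec (∃ P)
any-finite? F {P} P? = map′ (map₂ proj₂ ∘ find) (λ (x , px) → lose (complete F x) px) (Any.any? P? (elements F))

¬¬-all : {P : X → Set} (xs : List X) → (∀ x → ¬ ¬ P x) → ¬ ¬ All P xs
¬¬-all []       f = return []
¬¬-all (x ∷ xs) f = f x >>= λ px → ¬¬-all xs f >>= λ pxs → return (px ∷ pxs)

-- The double-negation shift holds here because the range is exhausted by a list.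
¬¬-∀ : Finite X → {P : X → Set} → (∀ x → ¬ ¬ P x) → ¬ ¬ (∀ x → P x)
¬¬-∀ F f = ¬¬-all (elements F) f >>= λ ps → return λ x → All.lookup ps (complete F x)

abstract

  Fin-finite : ∀ n → Finite (Fin n)
  Fin-finite n = record { elements = allFin n ; complete = ∈-allFin }

  Bool-finite : Finite Bool
  Bool-finite = record { elements = false ∷ true ∷ [] ; complete = λ { false → here refl ; true → there (here refl) } }

  ⊤-finite : Finite ⊤
  ⊤-finite = record { elements = tt ∷ [] ; complete = λ _ → here refl }

  _×-finite_ : Finite X → Finite Y → Finite (X × Y)
  F ×-finite G = record
    { elements = cartesianProduct (elements F) (elements G)
    ; complete = λ (x , y) → ∈-cartesianProduct⁺ (complete F x) (complete G y)
    }

  Vec-finite : Finite X → ∀ n → Finite (Vec X n)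
  Vec-finite {X} F n = record { elements = vectors n ; complete = vectors-complete }
    where
    vectors : ∀ n → List (Vec X n)
    vectors zero    = [] ∷ []
    vectors (suc n) = cartesianProductWith _∷_ (elements F) (vectors n)
    vectors-complete : ∀ {n} (v : Vec X n) → v ∈ vectors n
    vectors-complete []      = here refl
    vectors-complete (x ∷ v) = ∈-cartesianProductWith⁺ _∷_ (complete F x) (vectors-complete v)

-- Vectors stand in for functions on a finite type, so that these form a finite type with decidable
-- equality.
Table : Finite X → Set → Set
Table F Y = Vec Y (length (elements F))

apply : (F : Finite X) → Table F Y → X → Y
apply F g x = lookup g (index (complete F x))

table : (F : Finite X) → (X → Y) → Table F Y
table F f = tabulate (f ∘ List.lookup (elements F))

apply-table : (F : Finite X) (f : X → Y) → ∀ x → apply F (table F f) x ≡ f x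
apply-table F f x = trans (Vec.lookup∘tabulate _ (index (complete F x))) (cong f (sym (lookup-index (complete F x))))

lookup-extensional : ∀ {n} {u v : Vec X n} → (∀ i → lookup u i ≡ lookup v i) → u ≡ v
lookup-extensional = Pointwise-≡⇒≡ ∘ ext

least : (P : ℕ → Set) → Decidable P → ∀ n → P n → ∃[ m ] (P m × (∀ l → l < m → ¬ P l))
least P P? n = go n (<-wellFounded n)
  where
  go : ∀ n → Acc _<_ n → P n → ∃[ m ] (P m × (∀ l → l < m → ¬ P l))
  go n (acc rs) pn with anyUpTo? P? n
  ... | yes (m , m<n , pm) = go m (rs m<n) pm
  ... | no none            = n , pn , λ l l<n pl → none (l , l<n , pl)

-- Finite grids of states and classifiers.

-- Truth values of n atoms occurring in the formula and of r atoms outside it.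
Label : ℕ → ℕ → Set
Label n r = Vec Bool n × Vec Bool r

Label-finite : ∀ n r → Finite (Label n r)
Label-finite n r = Vec-finite Bool-finite n ×-finite Vec-finite Bool-finite r

_≟-label_ : ∀ {n r} → DecidableEquality (Label n r)
_≟-label_ = Product.≡-dec (Vec.≡-dec Bool._≟_) (Vec.≡-dec Bool._≟_)

-- The labels of q states and the decisions of q classifiers on them, with repetitions allowed.
Grid : (n r k q : ℕ) → Set
Grid n r k q = Vec (Label n r) q × Vec (Vec (Fin k) q) q

Grid-finite : ∀ n r k q → Finite (Grid n r k q)
Grid-finite n r k q = Vec-finite (Label-finite n r) q ×-finite Vec-finite (Vec-finite (Fin-finite k) q) q

module _ {n r k q : ℕ} where

  label : Grid n r k q → Fin q → Label n r
  label (ls , _) = lookup ls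

  row : Grid n r k q → Fin q → Vec (Fin k) q
  row (_ , rows) = lookup rows

  -- Columns with equal labels become one state of the model, so every row has to agree on them.
  Coherent : Grid n r k q → Set
  Coherent Γ = ∀ i i' → label Γ i ≡ label Γ i' → ∀ j → lookup (row Γ j) i ≡ lookup (row Γ j) i'

  coherent? : Decidable Coherent
  coherent? Γ = Fin.all? λ i → Fin.all? λ i' → (label Γ i ≟-label label Γ i') →-dec
    (Fin.all? λ j → lookup (row Γ j) i Fin.≟ lookup (row Γ j) i')

-- Fresh atoms and their selection by bits.

module _ {A : Set} where

  atoms : ∀ {k} → Form A k → List A
  atoms (atom p) = p ∷ []
  atoms (t x)    = []
  atoms (¬' φ)   = atoms φ
  atoms (φ ∧' ψ) = atoms φ ++ atoms ψ
  atoms (□I φ)   = atoms φ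
  atoms (□F φ)   = atoms φ

  -- Demanding the first r atoms outside L makes e unique, so that states built
  -- from it can be compared although e is only ¬¬-available.
  Initial : (A → ℕ) → List A → ∀ {r} → Vec A r → Set
  Initial code L []      = ⊤
  Initial code L (a ∷ e) = a ∉ L × (∀ b → b ∉ L → code a ≤ code b) × Initial code (a ∷ L) e

  select : ∀ {r} → Vec A r → Vec Bool r → List A
  select []      []          = []
  select (a ∷ e) (true ∷ β)  = a ∷ select e β
  select (a ∷ e) (false ∷ β) = select e β

  select-none : ∀ {r} (e : Vec A r) κ → select e (zipWith _xor_ κ κ) ≡ []
  select-none []      []          = refl
  select-none (a ∷ e) (true ∷ κ)  = select-none e κ
  select-none (a ∷ e) (false ∷ κ) = select-none e κ

xor-injective : ∀ {r} (κ₀ : Vec Bool r) {κ κ'} → zipWith _xor_ κ κ₀ ≡ zipWith _xor_ κ' κ₀ → κ ≡ κ'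
xor-injective []       {[]}    {[]}      _  = refl
xor-injective (b ∷ κ₀) {c ∷ κ} {c' ∷ κ'} eq =
  cong₂ _∷_ (go b c c' (Vec.∷-injectiveˡ eq)) (xor-injective κ₀ (Vec.∷-injectiveʳ eq))
  where
  go : ∀ b c c' → c xor b ≡ c' xor b → c ≡ c'
  go b     true  true  _ = refl
  go b     false false _ = refl
  go true  true  false ()
  go false true  false ()
  go true  false true  ()
  go false false true  ()

Unique-lookup-injective : {xs : List X} → Unique xs → ∀ i j → List.lookup xs i ≡ List.lookup xs j → i ≡ j
Unique-lookup-injective (x∉ ∷ u) zero    zero    _  = refl
Unique-lookup-injective (x∉ ∷ u) zero    (suc j) eq = ⊥-elim (All.lookup x∉ (∈-lookup j) eq)
Unique-lookup-injective (x∉ ∷ u) (suc i) zero    eq = ⊥-elim (All.lookup x∉ (∈-lookup i) (sym eq))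
Unique-lookup-injective (x∉ ∷ u) (suc i) (suc j) eq = cong suc (Unique-lookup-injective u i j eq)

-- Stability of truth and finite descriptions of worlds.

does-true : (P? : Dec X) → does P? ≡ true ⇔ X
does-true (yes p) = mk⇔ (λ _ → p) (λ _ → refl)
does-true (no ¬p) = mk⇔ (λ ()) (⊥-elim ∘ ¬p)

¬¬-bits : ∀ {d} (P : Fin d → Set) → ¬ ¬ (Σ (Vec Bool d) λ τ → ∀ n → lookup τ n ≡ true ⇔ P n)
¬¬-bits P = ¬¬-∀ (Fin-finite _) (λ n → ¬¬-excluded-middle {A = P n}) >>= λ P? → return
  (tabulate (does ∘ P?) , λ n → subst (λ b → b ≡ true ⇔ P n) (sym (Vec.lookup∘tabulate (does ∘ P?) n)) (does-true (P? n)))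

boxed : ∀ {A k} → Form A k → List (Form A k)
boxed (atom p) = []
boxed (t x)    = []
boxed (¬' φ)   = boxed φ
boxed (φ ∧' ψ) = boxed φ ++ boxed ψ
boxed (□I φ)   = φ ∷ boxed φ
boxed (□F φ)   = φ ∷ boxed φ

-- Atoms are Boolean, and `¬'`, `∧'` and the boxes preserve stability.
⊨D-stable : ∀ {A k} (M : MDM A k) w φ → ¬ ¬ ⊨D M w φ → ⊨D M w φ
⊨D-stable M w (atom p) h = decidable-stable (_ Bool.≟ true) h
⊨D-stable M w (t x)    h = decidable-stable (_ Bool.≟ true) h
⊨D-stable M w (¬' φ)   h = λ a → h λ f → f a
⊨D-stable M w (φ ∧' ψ) h =
  ⊨D-stable M w φ (h >>= λ (a , _) → return a) , ⊨D-stable M w ψ (h >>= λ (_ , b) → return b)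
⊨D-stable M w (□I φ)   h = λ v r → ⊨D-stable M v φ (h >>= λ f → return (f v r))
⊨D-stable M w (□F φ)   h = λ v r → ⊨D-stable M v φ (h >>= λ f → return (f v r))

module Description (n r d k : ℕ) {G : Set} (G-finite : Finite G) where

  Column : Set
  Column = Label n r × Vec Bool d

  -- `G` is what rows record besides box truths: nothing in the tagged case, the induced function in
  -- the covered case.
  Row : Set
  Row = G × Vec Bool d

  Desc : Set
  Desc = (Column × Row) × Fin k

  abstract
    Desc-finite : Finite Desc
    Desc-finite = ((Label-finite n r ×-finite Vec-finite Bool-finite d) ×-finite (G-finite ×-finite Vec-finite Bool-finite d))
      ×-finite Fin-finite k

    codes : Finite (Bool × Desc)
    codes = Bool-finite ×-finite Desc-finite

  -- Realised or not, all codes are counted. The side of the grid is thus known before the model is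
  -- examined, and grid satisfiability stays decidable.
  size : ℕ
  size = length (elements codes)

  column : Desc → Column
  column = proj₁ ∘ proj₁

  rowOf : Desc → Row
  rowOf = proj₂ ∘ proj₁

module Decision {A : Set} {k : ℕ} (M : MDM A k) where
  open MDM M

  decision : W → Fin k
  decision w = proj₁ (C5 w)

  decision-unique : ∀ w {x} → V w (inj₂ x) ≡ true → decision w ≡ x
  decision-unique w {x} eq with decision w Fin.≟ x
  ... | yes ≡x = ≡x
  ... | no  ≢x with () ← trans (sym eq) (C4 w (decision w) x (proj₂ (C5 w)) ≢x)

  decision-⇔ : ∀ w x → decision w ≡ x ⇔ V w (inj₂ x) ≡ true
  decision-⇔ w x = mk⇔ (λ { refl → proj₂ (C5 w) }) (decision-unique w)

  worldLabel : ∀ (L : List A) {r} → Vec A r → W → Label (length L) r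
  worldLabel L e w = tabulate (V w ∘ inj₁ ∘ List.lookup L) , Vec.map (V w ∘ inj₁) e

-- These descriptions carry no fresh bits; the tags are added to the grid afterwards, one per
-- column, so this number also counts the fresh atoms.
taggedSize : (n d k : ℕ) → ℕ
taggedSize n d k = Description.size n 0 d k ⊤-finite

coveredSize : (n d k r : ℕ) → ℕ
coveredSize n d k r = Description.size n r d k (Vec-finite (Fin-finite k) (length (elements (Label-finite n r))))

oneHot : ∀ {q} → Fin q → Vec Bool q
oneHot i = tabulate λ j → does (i Fin.≟ j)

oneHot-injective : ∀ {q} {i i' : Fin q} → oneHot i ≡ oneHot i' → i ≡ i'
oneHot-injective {i = i} {i'} eq = to (does-true (i Fin.≟ i')) (trans (sym (Vec.lookup∘tabulate _ i'))
  (trans (cong (λ v → lookup v i') eq) (trans (Vec.lookup∘tabulate _ i') (dec-true (i' Fin.≟ i') refl))))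

-- Enumerating the atoms outside a list.

module Enumeration {A : Set} (code : A → ℕ) (code-injective : ∀ {a b} → code a ≡ code b → a ≡ b) where

  _≟_ : DecidableEquality A
  a ≟ b = map′ code-injective (cong code) (code a Data.Nat.≟ code b)

  open import Data.List.Membership.DecPropositional _≟_ public using (_∈?_)

  -- Two minimal codes bound each other, and the code is injective.
  Initial-unique : ∀ {r} L (e e' : Vec A r) → Initial code L e → Initial code L e' → e ≡ e'
  Initial-unique L []      []        _                _                  = refl
  Initial-unique L (a ∷ e) (a' ∷ e') (a∉ , min , ini) (a'∉ , min' , ini')
    with refl ← code-injective (≤-antisym (min a' a'∉) (min' a a∉)) = cong (a ∷_) (Initial-unique (a ∷ L) e e' ini ini')

  select-fresh : ∀ {r} L (e : Vec A r) β → Initial code L e → ∀ {p} → p ∈ select e β → p ∉ L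
  select-fresh L []      []          ini            ()
  select-fresh L (a ∷ e) (true ∷ β)  (a∉ , _ , ini) (here refl) = a∉
  select-fresh L (a ∷ e) (true ∷ β)  (a∉ , _ , ini) (there p∈)  = select-fresh (a ∷ L) e β ini p∈ ∘ there
  select-fresh L (a ∷ e) (false ∷ β) (a∉ , _ , ini) p∈          = select-fresh (a ∷ L) e β ini p∈ ∘ there

  -- The entries of `e` are distinct and lie outside `L`, so whether `a` is selected reveals its
  -- bit; the induction on the rest runs with `a ∷ L`.
  select-injective : ∀ {r} L (e : Vec A r) β β' → Initial code L e →
    (∀ p → p ∉ L → p ∈ select e β ⇔ p ∈ select e β') → β ≡ β'
  select-injective L []      []      []        ini           h = refl
  select-injective L (a ∷ e) (b ∷ β) (b' ∷ β') (a∉ , _ , ini) h = step b b' h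
    where
    a∉select : ∀ β → a ∉ select e β
    a∉select β a∈ = select-fresh (a ∷ L) e β ini a∈ (here refl)
    shrink : ∀ {p β} → p ∉ a ∷ L → p ∈ a ∷ select e β → p ∈ select e β
    shrink p∉ (here refl) = ⊥-elim (p∉ (here refl))
    shrink p∉ (there p∈)  = p∈
    step : ∀ b b' → (∀ p → p ∉ L → p ∈ select (a ∷ e) (b ∷ β) ⇔ p ∈ select (a ∷ e) (b' ∷ β')) → b ∷ β ≡ b' ∷ β'
    step true true h = cong (true ∷_) (select-injective (a ∷ L) e β β' ini λ p p∉ →
      mk⇔ (shrink p∉ ∘ to (h p (p∉ ∘ there)) ∘ there) (shrink p∉ ∘ from (h p (p∉ ∘ there)) ∘ there))
    step false false h = cong (false ∷_) (select-injective (a ∷ L) e β β' ini λ p p∉ → h p (p∉ ∘ there))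
    step true false h = ⊥-elim (a∉select β' (to (h a a∉) (here refl)))
    step false true h = ⊥-elim (a∉select β (from (h a a∉) (here refl)))

  ¬¬-minimal : (Q : A → Set) → ∃ Q → ¬ ¬ (∃[ a ] (Q a × (∀ b → Q b → code a ≤ code b)))
  ¬¬-minimal Q (a , qa) = go a (<-wellFounded (code a)) qa
    where
    go : ∀ a → Acc _<_ (code a) → Q a → ¬ ¬ (∃[ a ] (Q a × (∀ b → Q b → code a ≤ code b)))
    go a (acc rs) qa = ¬¬-excluded-middle {A = ∃[ b ] (Q b × code b < code a)} >>= λ where
      (yes (b , qb , b<a)) → go b (rs b<a) qb
      (no none)            → return (a , qa , λ b qb → ≮⇒≥ λ b<a → none (b , qb , b<a))

  Covers : List A → ∀ {r} → Vec A r → Set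
  Covers L e = ∀ a → a ∈ L ⊎ (∃[ i ] lookup e i ≡ a)

  Covers-∷ : ∀ {L r} a (e : Vec A r) → Covers (a ∷ L) e → Covers L (a ∷ e)
  Covers-∷ a e cov b with cov b
  ... | inj₁ (here refl) = inj₂ (zero , refl)
  ... | inj₁ (there b∈)  = inj₁ b∈
  ... | inj₂ (i , eq)    = inj₂ (suc i , eq)

  -- Least atoms outside the list are taken one by one. If they run out, the fewer than `r` atoms
  -- found so far and `L` exhaust `A`.
  ¬¬-enumerate : ∀ r L → ¬ ¬ ((∃[ e ] Initial code L {r} e) ⊎ (∃[ r' ] (r' < r × (∃[ e ] Covers L {r'} e))))
  ¬¬-enumerate zero    L = return (inj₁ ([] , tt))
  ¬¬-enumerate (suc r) L = ¬¬-excluded-middle {A = ∃[ a ] a ∉ L} >>= λ where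
    (no none) → return (inj₂ (0 , s≤s z≤n , [] , λ a → inj₁ (decidable-stable (a ∈? L) λ a∉ → none (a , a∉))))
    (yes some) → ¬¬-minimal (_∉ L) some >>= λ (a , a∉ , min) → ¬¬-enumerate r (a ∷ L) >>= λ where
      (inj₁ (e , ini)) → return (inj₁ (a ∷ e , a∉ , min , ini))
      (inj₂ (r' , r'<r , e , cov)) → return (inj₂ (suc r' , s≤s r'<r , a ∷ e , Covers-∷ a e cov))

  -- Truth in grids.

  module Evaluation (L : List A) where

    -- The last argument is the value on atoms outside L.
    valueAt : Vec Bool (length L) → A → Bool → Bool
    valueAt ℓ p b with p ∈? L
    ... | yes p∈ = lookup ℓ (index p∈)
    ... | no  _  = b

    valueAt-∈ : ∀ ℓ {p} b b' → p ∈ L → valueAt ℓ p b ≡ valueAt ℓ p b'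
    valueAt-∈ ℓ {p} b b' p∈ with p ∈? L
    ... | yes _ = refl
    ... | no p∉ = ⊥-elim (p∉ p∈)

    valueAt-∉ : ∀ ℓ {p} b → p ∉ L → valueAt ℓ p b ≡ b
    valueAt-∉ ℓ {p} b p∉ with p ∈? L
    ... | yes p∈ = ⊥-elim (p∉ p∈)
    ... | no _   = refl

    valueAt-tabulate : ∀ (V : A → Bool) {p} b → p ∈ L → valueAt (tabulate (V ∘ List.lookup L)) p b ≡ V p
    valueAt-tabulate V {p} b p∈ with p ∈? L
    ... | yes m = trans (Vec.lookup∘tabulate (V ∘ List.lookup L) (index m)) (cong V (sym (lookup-index m)))
    ... | no p∉ = ⊥-elim (p∉ p∈)

    valueAt-lookup : Unique L → ∀ ℓ i b → valueAt ℓ (List.lookup L i) b ≡ lookup ℓ i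
    valueAt-lookup uniq ℓ i b with List.lookup L i ∈? L
    ... | yes m = cong (lookup ℓ) (Unique-lookup-injective uniq (index m) i (sym (lookup-index m)))
    ... | no p∉ = ⊥-elim (p∉ (∈-lookup i))

    module _ {r k q : ℕ} (Γ : Grid (length L) r k q) where

      -- Only named bits are evaluated; the fresh bits enter through `Coherent`, where they separate
      -- columns.
      ⊨G : Fin q → Fin q → Form A k → Set
      ⊨G i j (atom p) = valueAt (proj₁ (label Γ i)) p false ≡ true
      ⊨G i j (t x)    = lookup (row Γ j) i ≡ x
      ⊨G i j (¬' φ)   = ¬ ⊨G i j φ
      ⊨G i j (φ ∧' ψ) = ⊨G i j φ × ⊨G i j ψ
      ⊨G i j (□I φ)   = ∀ i' → ⊨G i' j φ
      ⊨G i j (□F φ)   = ∀ j' → ⊨G i j' φ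

      ⊨G? : ∀ i j φ → Dec (⊨G i j φ)
      ⊨G? i j (atom p) = _ Bool.≟ true
      ⊨G? i j (t x)    = _ Fin.≟ x
      ⊨G? i j (¬' φ)   = ¬? (⊨G? i j φ)
      ⊨G? i j (φ ∧' ψ) = ⊨G? i j φ ×-dec ⊨G? i j ψ
      ⊨G? i j (□I φ)   = Fin.all? λ i' → ⊨G? i' j φ
      ⊨G? i j (□F φ)   = Fin.all? λ j' → ⊨G? i j' φ

    GridSat : ∀ {k} → Form A k → (r q : ℕ) → Set
    GridSat {k} φ r q = Σ (Grid (length L) r k q) λ Γ → Coherent Γ × ∃[ i ] ∃[ j ] ⊨G Γ i j φ

    gridSat? : ∀ {k} (φ : Form A k) r q → Dec (GridSat φ r q)
    gridSat? φ r q = any-finite? (Grid-finite _ _ _ _) λ Γ →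
      coherent? Γ ×-dec Fin.any? λ i → Fin.any? λ j → ⊨G? Γ i j φ

    -- From a coherent grid to a multi-classifier model.

    module Realisation {r k q : ℕ} (uniq : Unique L) (Γ : Grid (length L) r k q) (coh : Coherent Γ) (i₀ : Fin q)
      (fresh : ¬ ¬ (∃[ e ] Initial code L {r} e)) where

      -- Relative to i₀, whose state thus makes no fresh atom true and can be
      -- written down without knowing any.
      flipped : Label (length L) r → Vec Bool r
      flipped ℓ = zipWith _xor_ (proj₂ ℓ) (proj₂ (label Γ i₀))

      -- The witnesses are irrelevant, so a state is determined by its label and its list of fresh
      -- atoms. Since an initial `e` is unique, having it under double negation suffices.
      record State : Set where
        constructor state
        field
          lab  : Label (length L) r
          true-atoms : List A
          .occurs  : ∃[ i ] label Γ i ≡ lab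
          .chosen : ¬ ¬ (∃[ e ] (Initial code L e × true-atoms ≡ select e (flipped lab)))

      open State

      -- Stored by values, since equal rows of the grid must yield one and the same classifier.
      record Classifier : Set where
        constructor classifier
        field
          values : Vec (Fin k) q
          .is-row : ∃[ j ] row Γ j ≡ values

      open Classifier

      stateIndex : (s : State) → ∃[ i ] label Γ i ≡ lab s
      stateIndex (state ℓ _ occurs _) = recompute (Fin.any? λ i → label Γ i ≟-label ℓ) occurs

      rowIndex : (f : Classifier) → ∃[ j ] row Γ j ≡ values f
      rowIndex (classifier v is-row) = recompute (Fin.any? λ j → Vec.≡-dec Fin._≟_ (row Γ j) v) is-row

      stateAt : ∀ i → ¬ ¬ (Σ State λ s → lab s ≡ label Γ i)
      stateAt i = fresh >>= λ (e , ini) → return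
        (state (label Γ i) (select e (flipped (label Γ i))) (i , refl) (return (e , ini , refl)) , refl)

      initialState : State
      initialState = state (label Γ i₀) [] (i₀ , refl)
        (fresh >>= λ (e , ini) → return (e , ini , sym (select-none e (proj₂ (label Γ i₀)))))

      valuation : State → A → Bool
      valuation s p = valueAt (proj₁ (lab s)) p (does (p ∈? true-atoms s))

      state-≡ : ∀ {s s'} → lab s ≡ lab s' → true-atoms s ≡ true-atoms s' → s ≡ s'
      state-≡ refl refl = refl

      does-≡⇒⇔ : ∀ {P Q : Set} (P? : Dec P) (Q? : Dec Q) → does P? ≡ does Q? → P ⇔ Q
      does-≡⇒⇔ (yes p) (yes q) _ = mk⇔ (λ _ → q) (λ _ → p)
      does-≡⇒⇔ (no ¬p) (no ¬q) _ = mk⇔ (⊥-elim ∘ ¬p) (⊥-elim ∘ ¬q)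

      -- Atoms of `L` recover the named bits. The other atoms recover the fresh true ones, and
      -- uniqueness of `e` turns equal selections into equal bits.
      valuation-injective : ∀ s s' → (∀ p → valuation s p ≡ valuation s' p) → s ≡ s'
      valuation-injective s@(state _ _ _ chosen) s'@(state _ _ _ chosen') eq = state-≡ (cong₂ _,_ named fresh-eq) atoms-eq
        where
        named : proj₁ (lab s) ≡ proj₁ (lab s')
        named = lookup-extensional λ i → trans (sym (valueAt-lookup uniq _ i _))
          (trans (eq (List.lookup L i)) (valueAt-lookup uniq _ i _))
        same-members : ∀ p → p ∉ L → p ∈ true-atoms s ⇔ p ∈ true-atoms s'
        same-members p p∉ = does-≡⇒⇔ (p ∈? true-atoms s) (p ∈? true-atoms s')
          (trans (sym (valueAt-∉ _ _ p∉)) (trans (eq p) (valueAt-∉ _ _ p∉)))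
        both : .(¬ ¬ (∃[ e ] (Initial code L e × true-atoms s ≡ select e (flipped (lab s))))) →
               .(¬ ¬ (∃[ e ] (Initial code L e × true-atoms s' ≡ select e (flipped (lab s'))))) →
               proj₂ (lab s) ≡ proj₂ (lab s') × true-atoms s ≡ true-atoms s'
        -- Both equalities are decidable, which licenses the irrelevant and doubly negated
        -- witnesses.
        both c c' = recompute both? (decidable-stable both? (c >>= λ (e , ini , X≡) → c' >>= λ (e' , ini' , X'≡) →
          return (joint e e' ini ini' X≡ X'≡)))
          where
          both? = Vec.≡-dec Bool._≟_ (proj₂ (lab s)) (proj₂ (lab s')) ×-dec List.≡-dec _≟_ (true-atoms s) (true-atoms s')
          joint : ∀ e e' → Initial code L e → Initial code L e' → true-atoms s ≡ select e (flipped (lab s)) →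
            true-atoms s' ≡ select e' (flipped (lab s')) → proj₂ (lab s) ≡ proj₂ (lab s') × true-atoms s ≡ true-atoms s'
          joint e e' ini ini' X≡ X'≡ with refl ← Initial-unique L e e' ini ini' =
            xor-injective _ β≡ , trans X≡ (trans (cong (select e) β≡) (sym X'≡))
            where
            β≡ : flipped (lab s) ≡ flipped (lab s')
            β≡ = select-injective L e _ _ ini λ p p∉ → mk⇔
              (subst (p ∈_) X'≡ ∘ to (same-members p p∉) ∘ subst (p ∈_) (sym X≡))
              (subst (p ∈_) X≡ ∘ from (same-members p p∉) ∘ subst (p ∈_) (sym X'≡))
        fresh-eq = proj₁ (both chosen chosen')
        atoms-eq = proj₂ (both chosen chosen')

      decide : Classifier → State → Fin k
      decide f s = lookup (values f) (proj₁ (stateIndex s))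

      -- Coherence makes the value independent of the index that the search in `stateIndex` returns.
      decide-at : ∀ f s i → lab s ≡ label Γ i → decide f s ≡ lookup (values f) i
      decide-at f s i eq with stateIndex s | rowIndex f
      ... | i' , eq' | j , refl = coh i' i (trans eq' eq) j

      classifier-≡ : ∀ {f f'} → values f ≡ values f' → f ≡ f'
      classifier-≡ refl = refl

      -- Every column has a state up to double negation, and equality of decisions is stable.
      decide-injective : ∀ f f' → (∀ s → decide f s ≡ decide f' s) → f ≡ f'
      decide-injective f f' eq = classifier-≡ (lookup-extensional λ i → decidable-stable (_ Fin.≟ _)
        (stateAt i >>= λ (s , at) → return (trans (sym (decide-at f s i at)) (trans (eq s) (decide-at f' s i at)))))

      model : MCM A k
      model = record { St = State ; st = valuation ; st-inj = valuation-injective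
                     ; Fn = Classifier ; cl = decide ; cl-inj = decide-injective }

      truth : ∀ φ → (∀ {p} → p ∈ atoms φ → p ∈ L) → ∀ {s f i j} → lab s ≡ label Γ i → values f ≡ row Γ j →
        ⊨C model s f φ ⇔ ⊨G Γ i j φ
      truth (atom p) sub {i = i} refl _ = mk⇔ (trans (sym same)) (trans same)
        where same = valueAt-∈ (proj₁ (label Γ i)) _ false (sub (here refl))
      truth (t x) sub {s} {f} {i} at refl = mk⇔ (trans (sym same)) (trans same)
        where same = decide-at f s i at
      truth (¬' φ) sub {s} {f} at at' = mk⇔ (_∘ from ih) (_∘ to ih)
        where ih = truth φ sub {s} {f} at at'
      truth (φ ∧' ψ) sub {s} {f} at at' = mk⇔
        (λ (a , b) → to left a , to right b) (λ (a , b) → from left a , from right b)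
        where
        left = truth φ (sub ∘ ∈-++⁺ˡ) {s} {f} at at'
        right = truth ψ (sub ∘ ∈-++⁺ʳ (atoms φ)) {s} {f} at at'
      truth (□I φ) sub {f = f} {j = j} at at' = mk⇔
        -- The state at column `i'` is available only under double negation; decidability of grid
        -- truth removes it.
        (λ h i' → decidable-stable (⊨G? Γ i' j φ) (stateAt i' >>= λ (s' , at'') → return (to (truth φ sub {s'} {f} at'' at') (h s'))))
        (λ h s' → from (truth φ sub {s'} {f} (sym (proj₂ (stateIndex s'))) at') (h _))
      truth (□F φ) sub {s} at at' = mk⇔
        (λ h j' → to (truth φ sub {s} at refl) (h (classifier (row Γ j') (j' , refl))))
        (λ h f' → from (truth φ sub {s} {f'} at (sym (proj₂ (rowIndex f')))) (h _))

  -- Filtration of a multi-decision model.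

  -- Good w g is additional information g about the ~I-class of w.
  module Filtration {k : ℕ} (L : List A) (M : MDM A k) (w₀ : MDM.W M) (Δ : List (Form A k)) {r : ℕ} (e : Vec A r)
      {G : Set} (G-finite : Finite G) (_≟G_ : DecidableEquality G) (Good : MDM.W M → G → Set)
      (Good-inv : ∀ {v u g} → MDM._~I_ M v u → Good v g → Good u g) (Good-ex : ∀ v → ¬ ¬ ∃ (Good v)) where

    open MDM M
    open Evaluation L
    open Description (length L) r (length Δ) k G-finite
    open Decision M
    module I = IsEquivalence ~I-equiv
    module F = IsEquivalence ~F-equiv

    -- By `C1` this is the whole component of `w₀`. Within it any realised column and row parts can
    -- be combined.
    Reachable : W → Set
    Reachable v = ∃[ u ] (w₀ ~I u × u ~F v)

    IsColumn : W → Column → Set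
    IsColumn v (ℓ , τ) = worldLabel L e v ≡ ℓ × (∀ n → lookup τ n ≡ true ⇔ (∀ u → v ~F u → ⊨D M u (List.lookup Δ n)))

    IsRow : W → Row → Set
    IsRow v (g , τ) = Good v g × (∀ n → lookup τ n ≡ true ⇔ (∀ u → v ~I u → ⊨D M u (List.lookup Δ n)))

    Describes : W → Desc → Set
    Describes v ((c , ρ) , x) = IsColumn v c × IsRow v ρ × decision v ≡ x

    Realised : Desc → Set
    Realised δ = ∃[ v ] (Reachable v × Describes v δ)

    -- The label is constant along `~F` by `C3`; the box truths speak of the whole `~F`-class.
    IsColumn-inv : ∀ {v u} c → v ~F u → IsColumn v c → IsColumn u c
    IsColumn-inv {v} {u} _ r (refl , h) =
      cong₂ _,_ (Vec.tabulate-cong (λ i → sym (C3 v u r _))) (Vec.map-cong (λ a → sym (C3 v u r a)) e) ,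
      λ n → mk⇔ (λ eq z r' → to (h n) eq z (F.trans r r')) (λ f → from (h n) λ z r' → f z (F.trans (F.sym r) r'))

    IsRow-inv : ∀ {v u} ρ → v ~I u → IsRow v ρ → IsRow u ρ
    IsRow-inv _ r (g , h) = Good-inv r g ,
      λ n → mk⇔ (λ eq z r' → to (h n) eq z (I.trans r r')) (λ f → from (h n) λ z r' → f z (I.trans (I.sym r) r'))

    IsColumn-ex : ∀ v → ¬ ¬ ∃ (IsColumn v)
    IsColumn-ex v = ¬¬-bits _ >>= λ (τ , h) → return ((worldLabel L e v , τ) , refl , h)

    IsRow-ex : ∀ v → ¬ ¬ ∃ (IsRow v)
    IsRow-ex v = Good-ex v >>= λ (g , good) → ¬¬-bits _ >>= λ (τ , h) → return ((g , τ) , good , h)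

    Reachable-I : ∀ {v u} → Reachable v → v ~I u → Reachable u
    Reachable-I {v} {u} (a , w₀a , av) vu =
      let b , ab , bu = proj₂ (C1 a u) (v , av , vu) in b , I.trans w₀a ab , bu

    -- Going from `v` by `~F` to `a`, then by `~I` through `w₀` to `a'`, `C1` gives `b` with
    -- `v ~I b` and `b ~F a'`. So `b` keeps the row part of `v` and, as `a' ~F v'`, the column part
    -- of `v'`.
    mix : ∀ δ δ' → Realised δ → Realised δ' → ∃[ x ] (Realised (((column δ') , rowOf δ) , x))
    mix δ δ' (v , (a , w₀a , av) , _ , ρ , _) (v' , (a' , w₀a' , a'v') , c , _) =
      let b , vb , ba' = proj₂ (C1 v a') (a , F.sym av , I.trans (I.sym w₀a) w₀a')
          reach = Reachable-I (a , w₀a , av) vb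
      in decision b , b , reach , IsColumn-inv (column δ') (F.sym (F.trans ba' a'v')) c , IsRow-inv (rowOf δ) vb ρ , refl

    column-≟ : DecidableEquality Column
    column-≟ = Product.≡-dec _≟-label_ (Vec.≡-dec Bool._≟_)

    row-≟ : DecidableEquality Row
    row-≟ = Product.≡-dec _≟G_ (Vec.≡-dec Bool._≟_)

    module _ (realised? : ∀ δ → Dec (Realised δ)) (δ₀ : Desc) (δ₀-describes : Describes w₀ δ₀) where

      δ₀-realised : Realised δ₀
      δ₀-realised = w₀ , (w₀ , I.refl , F.refl) , δ₀-describes

      -- Unrealised descriptions give way to that of `w₀`, so every index of the grid of fixed
      -- `size` carries a realised one.
      normalise : Desc → Σ Desc Realised
      normalise δ with realised? δ
      ... | yes r = δ , r
      ... | no _  = δ₀ , δ₀-realised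

      normalise-realised : ∀ {δ} → Realised δ → proj₁ (normalise δ) ≡ δ
      normalise-realised {δ} r with realised? δ
      ... | yes _ = refl
      ... | no ¬r = ⊥-elim (¬r r)

      copy : Fin size → Bool
      copy i = proj₁ (List.lookup (elements codes) i)

      desc : Fin size → Desc
      desc i = proj₁ (normalise (proj₂ (List.lookup (elements codes) i)))

      desc-realised : ∀ i → Realised (desc i)
      desc-realised i = proj₂ (normalise (proj₂ (List.lookup (elements codes) i)))

      locate : ∀ b δ → Realised δ → ∃[ i ] (copy i ≡ b × desc i ≡ δ)
      locate b δ r = index m , sym (cong proj₁ (lookup-index m)) ,
        trans (cong (proj₁ ∘ normalise ∘ proj₂) (sym (lookup-index m))) (normalise-realised r)
        where m = complete codes (b , δ)

      candidate : Fin size → Fin size → Desc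
      candidate i j with copy i Bool.≟ copy j
      ... | yes _ = desc i
      ... | no  _ = desc j

      candidate-realised : ∀ i j → Realised (candidate i j)
      candidate-realised i j with copy i Bool.≟ copy j
      ... | yes _ = desc-realised i
      ... | no  _ = desc-realised j

      cellWith : ∀ i j δ → Realised δ → Dec (column δ ≡ column (desc i) × rowOf δ ≡ rowOf (desc j)) →
        Σ Desc λ δ → Realised δ × column δ ≡ column (desc i) × rowOf δ ≡ rowOf (desc j)
      cellWith i j δ r (yes fits) = δ , r , fits
      cellWith i j δ r (no _) =
        -- `mix` takes the row part from its first and the column part from its second argument.
        let x , r' = mix (desc j) (desc i) (desc-realised j) (desc-realised i) in _ , r' , refl , refl

      cells : ∀ i j → Σ Desc λ δ → Realised δ × column δ ≡ column (desc i) × rowOf δ ≡ rowOf (desc j)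
      cells i j = cellWith i j (candidate i j) (candidate-realised i j) (column-≟ _ _ ×-dec row-≟ _ _)

      cell : Fin size → Fin size → Desc
      cell i j = proj₁ (cells i j)

      cell-realised : ∀ i j → Realised (cell i j)
      cell-realised i j = proj₁ (proj₂ (cells i j))

      cell-column : ∀ i j → column (cell i j) ≡ column (desc i)
      cell-column i j = proj₁ (proj₂ (proj₂ (cells i j)))

      cell-row : ∀ i j → rowOf (cell i j) ≡ rowOf (desc j)
      cell-row i j = proj₂ (proj₂ (proj₂ (cells i j)))

      cell-candidate : ∀ i j {δ} → candidate i j ≡ δ → column δ ≡ column (desc i) → rowOf δ ≡ rowOf (desc j) → cell i j ≡ δ
      cell-candidate i j refl c ρ
        with column-≟ (column (candidate i j)) (column (desc i)) ×-dec row-≟ (rowOf (candidate i j)) (rowOf (desc j))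
      ... | yes _ = refl
      ... | no ¬fits = ⊥-elim (¬fits (c , ρ))

      candidate-row : ∀ i j → copy j ≡ not (copy i) → candidate i j ≡ desc j
      candidate-row i j eq with copy i Bool.≟ copy j
      ... | yes eq' = ⊥-elim (Bool.not-¬ refl (trans eq' eq))
      ... | no _ = refl

      candidate-column : ∀ i j → copy i ≡ copy j → candidate i j ≡ desc i
      candidate-column i j eq with copy i Bool.≟ copy j
      ... | yes _ = refl
      ... | no ¬eq = ⊥-elim (¬eq eq)

      -- In column `i` the rows of the opposite copy propose their own descriptions, so the one
      -- carrying `δ` fits. Within a row, the columns of the same copy do this.
      column-onto : ∀ i δ → Realised δ → column δ ≡ column (desc i) → ∃[ j ] cell i j ≡ δ
      column-onto i δ r c = let j , copy≡ , desc≡ = locate (not (copy i)) δ r in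
        j , cell-candidate i j (trans (candidate-row i j copy≡) desc≡) c (cong rowOf (sym desc≡))

      row-onto : ∀ j δ → Realised δ → rowOf δ ≡ rowOf (desc j) → ∃[ i ] cell i j ≡ δ
      row-onto j δ r ρ = let i , copy≡ , desc≡ = locate (copy j) δ r in
        i , cell-candidate i j (trans (candidate-column i j copy≡) desc≡) (cong column (sym desc≡)) ρ

      -- For coherence in the covered case: the world ties the decision in the cell to the label of
      -- the column and the function kept in the row.
      cell-witness : ∀ i j →
        ∃[ v ] (worldLabel L e v ≡ proj₁ (column (desc i)) × Good v (proj₁ (rowOf (desc j))) × decision v ≡ proj₂ (cell i j))
      cell-witness i j = let v , _ , (ℓ≡ , _) , (good , _) , x≡ = cell-realised i j in
        v , trans ℓ≡ (cong proj₁ (cell-column i j)) , subst (Good v ∘ proj₁) (cell-row i j) good , x≡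

      -- The fresh bits `κ` stay a parameter: tags in one use, the fresh part of the labels in the
      -- other.
      grid : ∀ {r'} → (Fin size → Vec Bool r') → Grid (length L) r' k size
      grid κ = tabulate (λ i → proj₁ (proj₁ (column (desc i))) , κ i) , tabulate λ j → tabulate λ i → proj₂ (cell i j)

      label-grid : ∀ {r'} (κ : Fin size → Vec Bool r') i → label (grid κ) i ≡ (proj₁ (proj₁ (column (desc i))) , κ i)
      label-grid κ i = Vec.lookup∘tabulate _ i

      row-grid : ∀ {r'} (κ : Fin size → Vec Bool r') i j → lookup (row (grid κ) j) i ≡ proj₂ (cell i j)
      row-grid κ i j = trans (cong (λ v → lookup v i) (Vec.lookup∘tabulate _ j)) (Vec.lookup∘tabulate _ i)

      module _ {r' : ℕ} (κ : Fin size → Vec Bool r') where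

        -- A box true in the grid is true in the model because every related world fills some cell
        -- of the row or column. The converse holds because box truths are bits that the row or
        -- column shares.
        truth : ∀ φ → (∀ {p} → p ∈ atoms φ → p ∈ L) → (∀ {ψ} → ψ ∈ boxed φ → ψ ∈ Δ) →
          ∀ i j v → Reachable v → Describes v (cell i j) → ⊨G (grid κ) i j φ ⇔ ⊨D M v φ
        truth (atom p) sub box i j v reach ((ℓ≡ , _) , _) = mk⇔ (trans (sym same)) (trans same)
          where
          same : valueAt (proj₁ (label (grid κ) i)) p false ≡ V v (inj₁ p)
          same = trans (cong (λ ℓ → valueAt ℓ p false)
              (trans (cong proj₁ (label-grid κ i)) (trans (cong (proj₁ ∘ proj₁) (sym (cell-column i j)))
                (cong proj₁ (sym ℓ≡)))))
            (valueAt-tabulate (V v ∘ inj₁) false (sub (here refl)))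
        truth (t x) sub box i j v reach (_ , _ , x≡) = mk⇔
          (to (decision-⇔ v x) ∘ trans (sym same)) (trans same ∘ from (decision-⇔ v x))
          where
          same : lookup (row (grid κ) j) i ≡ decision v
          same = trans (row-grid κ i j) (sym x≡)
        truth (¬' φ) sub box i j v reach d = mk⇔ (_∘ from ih) (_∘ to ih)
          where ih = truth φ sub box i j v reach d
        truth (φ ∧' ψ) sub box i j v reach d = mk⇔
          (λ (a , b) → to left a , to right b) (λ (a , b) → from left a , from right b)
          where
          left = truth φ (sub ∘ ∈-++⁺ˡ) (box ∘ ∈-++⁺ˡ) i j v reach d
          right = truth ψ (sub ∘ ∈-++⁺ʳ (atoms φ)) (box ∘ ∈-++⁺ʳ (boxed φ)) i j v reach d
        truth (□I φ) sub box i j v reach d@(_ , ρ , _) = mk⇔ forth back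
          where
          φ∈ = box (here refl)
          ih = λ i' v' → truth φ sub (box ∘ there) i' j v'
          forth : (∀ i' → ⊨G (grid κ) i' j φ) → ∀ u → v ~I u → ⊨D M u φ
          -- A description of `u` exists only up to double negation, and stability of truth in `M`
          -- absorbs this.
          forth h u vu = ⊨D-stable M u φ (IsColumn-ex u >>= λ (c , col) →
            let δ = (c , rowOf (cell i j)) , decision u
                d' : Describes u δ
                d' = col , IsRow-inv (rowOf (cell i j)) vu ρ , refl
                reach' = Reachable-I reach vu
                i' , eq = row-onto j δ (u , reach' , d') (cell-row i j)
            in return (to (ih i' u reach' (subst (Describes u) (sym eq) d')) (h i')))
          back : (∀ u → v ~I u → ⊨D M u φ) → ∀ i' → ⊨G (grid κ) i' j φ
          -- The bit for `□I φ` is shared by the cells of row `j`; at `v'` reflexivity of `~I` then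
          -- yields `φ`.
          back h i' = let v' , reach' , d' = cell-realised i' j in
            from (ih i' v' reach' d') (subst (⊨D M v') (sym (lookup-index φ∈))
              (to (proj₂ (proj₁ (proj₂ d')) (index φ∈)) bit v' I.refl))
            where
            bit = trans (cong (λ ρ → lookup (proj₂ ρ) (index φ∈)) (trans (cell-row i' j) (sym (cell-row i j))))
              (from (proj₂ ρ (index φ∈)) λ u vu → subst (⊨D M u) (lookup-index φ∈) (h u vu))
        truth (□F φ) sub box i j v reach@(a , w₀a , av) d@(c , _ , _) = mk⇔ forth back
          where
          φ∈ = box (here refl)
          ih = λ j' v' → truth φ sub (box ∘ there) i j' v'
          forth : (∀ j' → ⊨G (grid κ) i j' φ) → ∀ u → v ~F u → ⊨D M u φ
          forth h u vu = ⊨D-stable M u φ (IsRow-ex u >>= λ (ρ , isRow) →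
            let δ = (column (cell i j) , ρ) , decision u
                d' : Describes u δ
                d' = IsColumn-inv (column (cell i j)) vu c , isRow , refl
                reach' = a , w₀a , F.trans av vu
                j' , eq = column-onto i δ (u , reach' , d') (cell-column i j)
            in return (to (ih j' u reach' (subst (Describes u) (sym eq) d')) (h j')))
          back : (∀ u → v ~F u → ⊨D M u φ) → ∀ j' → ⊨G (grid κ) i j' φ
          back h j' = let v' , reach' , d' = cell-realised i j' in
            from (ih j' v' reach' d') (subst (⊨D M v') (sym (lookup-index φ∈))
              (to (proj₂ (proj₁ d') (index φ∈)) bit v' F.refl))
            where
            bit = trans (cong (λ ρ → lookup (proj₂ ρ) (index φ∈)) (trans (cell-column i j') (sym (cell-column i j))))
              (from (proj₂ c (index φ∈)) λ u vu → subst (⊨D M u) (lookup-index φ∈) (h u vu))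

        satisfied : ∀ φ → (∀ {p} → p ∈ atoms φ → p ∈ L) → (∀ {ψ} → ψ ∈ boxed φ → ψ ∈ Δ) → ⊨D M w₀ φ →
          ∃[ i ] ∃[ j ] ⊨G (grid κ) i j φ
        satisfied φ sub box h =
          let i , _ , desc≡ = locate true δ₀ δ₀-realised
              j , cell≡ = column-onto i δ₀ δ₀-realised (cong column (sym desc≡))
          in i , j , from (truth φ sub box i j w₀ (w₀ , I.refl , F.refl) (subst (Describes w₀) (sym cell≡) δ₀-describes)) h

    ¬¬-realised? : ¬ ¬ (∀ δ → Dec (Realised δ))
    ¬¬-realised? = ¬¬-∀ Desc-finite λ δ → ¬¬-excluded-middle

    ¬¬-δ₀ : ¬ ¬ ∃ (Describes w₀)
    ¬¬-δ₀ = IsColumn-ex w₀ >>= λ (c , col) → IsRow-ex w₀ >>= λ (ρ , isRow) → return (((c , ρ) , _) , col , isRow , refl)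

  -- Satisfying grids, by tags or by covering all atoms.

  module _ {k : ℕ} (L : List A) (M : MDM A k) (w₀ : MDM.W M) (φ : Form A k)
    (atoms⊆L : ∀ {p} → p ∈ atoms φ → p ∈ L) (w₀⊨φ : ⊨D M w₀ φ) where

    open MDM M
    open Evaluation L
    open Decision M
    module ~I = IsEquivalence ~I-equiv

    -- One-hot tags differ in different columns, so columns with equal labels coincide and coherence
    -- is immediate.
    taggedGridSat : ¬ ¬ GridSat φ (taggedSize (length L) (length (boxed φ)) k) (taggedSize (length L) (length (boxed φ)) k)
    taggedGridSat = ¬¬-realised? >>= λ realised? → ¬¬-δ₀ >>= λ (δ₀ , d) →
      return (grid realised? δ₀ d oneHot , coherent realised? δ₀ d , satisfied realised? δ₀ d oneHot φ atoms⊆L id w₀⊨φ)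
      where
      open Filtration L M w₀ (boxed φ) [] ⊤-finite (λ _ _ → yes refl) (λ _ _ → ⊤) (λ _ _ → tt) (λ _ → return (tt , tt))
      coherent : ∀ realised? δ₀ d → Coherent (grid realised? δ₀ d oneHot)
      coherent realised? δ₀ d i i' eq j = cong (lookup (row (grid realised? δ₀ d oneHot) j)) (oneHot-injective
        (cong proj₂ (trans (sym (label-grid realised? δ₀ d oneHot i)) (trans eq (label-grid realised? δ₀ d oneHot i')))))

    module _ {r : ℕ} (e : Vec A r) (covers : Covers L e) where

      labels : Finite (Label (length L) r)
      labels = Label-finite (length L) r

      same-label⇒same-valuation : ∀ {u v} → worldLabel L e u ≡ worldLabel L e v → ∀ p → V u (inj₁ p) ≡ V v (inj₁ p)
      same-label⇒same-valuation {u} {v} eq p with covers p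
      ... | inj₁ p∈ = trans (sym (valueAt-tabulate (V u ∘ inj₁) false p∈))
        (trans (cong (λ ℓ → valueAt (proj₁ ℓ) p false) eq) (valueAt-tabulate (V v ∘ inj₁) false p∈))
      ... | inj₂ (i , refl) = trans (sym (Vec.lookup-map i (V u ∘ inj₁) e))
        (trans (cong (λ ℓ → lookup (proj₂ ℓ) i) eq) (Vec.lookup-map i (V v ∘ inj₁) e))

      -- With all atoms covered, equal labels mean equal valuations, and `C2` applies.
      same-label⇒same-decision : ∀ {u v} → u ~I v → worldLabel L e u ≡ worldLabel L e v → decision u ≡ decision v
      same-label⇒same-decision {u} {v} r eq = decision-unique u
        (trans (C2 u v (same-label⇒same-valuation eq) r (decision v)) (proj₂ (C5 v)))

      Induces : W → Table labels (Fin k) → Set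
      Induces v g = ∀ u → v ~I u → apply labels g (worldLabel L e u) ≡ decision u

      ¬¬-induces : ∀ v → ¬ ¬ ∃ (Induces v)
      ¬¬-induces v = ¬¬-∀ labels value >>= λ f → return
        (table labels (proj₁ ∘ f) , λ u vu →
          trans (apply-table labels (proj₁ ∘ f) (worldLabel L e u)) (sym (proj₂ (f _) u vu refl)))
        where
        value : ∀ ℓ → ¬ ¬ (∃[ x ] (∀ u → v ~I u → worldLabel L e u ≡ ℓ → decision u ≡ x))
        value ℓ = ¬¬-excluded-middle {A = ∃[ u ] (v ~I u × worldLabel L e u ≡ ℓ)} >>= λ where
          (yes (u , vu , refl)) → return (decision u , λ u' vu' eq → same-label⇒same-decision (~I.trans (~I.sym vu') vu) eq)
          -- No world of the class has this label, so any value will do; `decision v` is at hand.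
          (no none) → return (decision v , λ u vu eq → ⊥-elim (none (u , vu , eq)))

      -- Each cell holds the value of the row's induced function at the label of its column. The
      -- grid keeps these labels in full, so equal labels force equal decisions.
      coveredGridSat : ¬ ¬ GridSat φ r (coveredSize (length L) (length (boxed φ)) k r)
      coveredGridSat = ¬¬-realised? >>= λ realised? → ¬¬-δ₀ >>= λ (δ₀ , d) →
        return (grid realised? δ₀ d (fresh realised? δ₀ d) , coherent realised? δ₀ d ,
          satisfied realised? δ₀ d (fresh realised? δ₀ d) φ atoms⊆L id w₀⊨φ)
        where
        open Filtration L M w₀ (boxed φ) e (Vec-finite (Fin-finite k) _) (Vec.≡-dec Fin._≟_) Induces
          (λ vu ind z uz → ind z (~I.trans vu uz)) ¬¬-induces
        open Description (length L) r (length (boxed φ)) k (Vec-finite (Fin-finite k) (length (elements labels)))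
        module _ (realised? : ∀ δ → Dec (Realised δ)) (δ₀ : Desc) (d : Describes w₀ δ₀) where
          fresh : Fin size → Vec Bool r
          fresh i = proj₂ (proj₁ (column (desc realised? δ₀ d i)))
          induced : Fin size → Table labels (Fin k)
          induced j = proj₁ (rowOf (desc realised? δ₀ d j))
          coherent : Coherent (grid realised? δ₀ d fresh)
          coherent i i' eq j = trans (read i) (trans
            (cong (apply labels (induced j))
              (trans (sym (label-grid realised? δ₀ d fresh i)) (trans eq (label-grid realised? δ₀ d fresh i'))))
            (sym (read i')))
            where
            read : ∀ i → lookup (row (grid realised? δ₀ d fresh) j) i ≡
              apply labels (induced j) (proj₁ (column (desc realised? δ₀ d i)))
            read i = let v , ℓ≡ , ind , x≡ = cell-witness realised? δ₀ d i j in
              trans (row-grid realised? δ₀ d fresh i j) (trans (sym x≡) (trans (sym (ind v ~I.refl)) (cong (apply labels (induced j)) ℓ≡)))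

  -- The least sufficient number of fresh atoms.

  SatMDM⇒SatMCM : ∀ {k} (φ : Form A k) → SatMDM φ → SatMCM φ
  SatMDM⇒SatMCM {k} φ (M , w₀ , w₀⊨φ) = build (least FreshSuffices freshSuffices? tags
    (decidable-stable (freshSuffices? tags) (taggedGridSat L M w₀ φ atoms⊆L w₀⊨φ >>= return ∘ inj₂)))
    where
    -- Without repetitions in `L`, valuations determine the named bits.
    L = deduplicate _≟_ (atoms φ)
    atoms⊆L : ∀ {p} → p ∈ atoms φ → p ∈ L
    atoms⊆L = ∈-deduplicate⁺ _≟_
    open Evaluation L
    tags = taggedSize (length L) (length (boxed φ)) k
    -- The second disjunct is known to hold at `r = tags`; the first is what a shorter cover of the
    -- atoms outside `L` would produce.
    FreshSuffices : ℕ → Set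
    FreshSuffices r = GridSat φ r (coveredSize (length L) (length (boxed φ)) k r) ⊎ GridSat φ r tags
    freshSuffices? : Decidable FreshSuffices
    freshSuffices? r = gridSat? φ r _ ⊎-dec gridSat? φ r _
    realise : ∀ {r q} → ¬ ¬ (∃[ e ] Initial code L {r} e) → GridSat φ r q → SatMCM φ
    realise fresh (Γ , coh , i , j , sat) = model , initialState , classifier (row Γ j) (j , refl) ,
      from (truth φ atoms⊆L {initialState} {classifier (row Γ j) (j , refl)} refl refl) sat
      where open Realisation (deduplicate-! _≟_ (atoms φ)) Γ coh i fresh
    build : ∃[ r ] (FreshSuffices r × (∀ r' → r' < r → ¬ FreshSuffices r')) → SatMCM φ
    build (r , suffices , minimal) = [ realise fresh , realise fresh ] suffices
      where
      fresh : ¬ ¬ (∃[ e ] Initial code L {r} e)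
      fresh = ¬¬-enumerate r L >>= λ where
        (inj₁ initial) → return initial
        -- Running out of atoms would make the smaller `r'` sufficient, against minimality.
        (inj₂ (r' , r'<r , e , covers)) → coveredGridSat L M w₀ φ atoms⊆L w₀⊨φ e covers >>= λ sat →
          ⊥-elim (minimal r' r'<r (inj₁ sat))

-- From multi-classifier models to multi-decision models.

module _ {A : Set} {k : ℕ} (Γ : MCM A k) where
  open MCM Γ

  -- `□I` varies the state, so `~I` fixes the classifier, and dually for `~F`. `C1` completes
  -- rectangles, and `C2` comes from injectivity of `st`.
  productModel : MDM A k
  productModel = record
    { W = St × Fn
    ; _~I_ = λ (_ , f) (_ , f') → f ≡ f'
    ; _~F_ = λ (s , _) (s' , _) → s ≡ s'
    ; V = λ { (s , f) (inj₁ p) → st s p ; (s , f) (inj₂ x) → does (cl f s Fin.≟ x) }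
    ; ~I-equiv = record { refl = refl ; sym = sym ; trans = trans }
    ; ~F-equiv = record { refl = refl ; sym = sym ; trans = trans }
    ; C1 = λ (s , f) (s' , f') → (λ { (_ , refl , refl) → (s , f') , refl , refl })
                               , (λ { (_ , refl , refl) → (s' , f) , refl , refl })
    ; C2 = λ { (s , f) (s' , _) eq refl x → cong (λ s → does (cl f s Fin.≟ x)) (st-inj s s' eq) }
    ; C3 = λ { _ _ refl p → refl }
    ; C4 = λ (s , f) x y eq x≢y → dec-false (cl f s Fin.≟ y) λ eq' → x≢y (trans (sym (to (does-true (cl f s Fin.≟ x)) eq)) eq')
    ; C5 = λ (s , f) → cl f s , dec-true (cl f s Fin.≟ cl f s) refl
    }

  productModel-truth : ∀ φ s f → ⊨C Γ s f φ ⇔ ⊨D productModel (s , f) φ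
  productModel-truth (atom p) s f = mk⇔ id id
  productModel-truth (t x)    s f = mk⇔ (from (does-true (cl f s Fin.≟ x))) (to (does-true (cl f s Fin.≟ x)))
  productModel-truth (¬' φ)   s f = mk⇔ (_∘ from ih) (_∘ to ih)
    where ih = productModel-truth φ s f
  productModel-truth (φ ∧' ψ) s f = mk⇔
    (λ (a , b) → to left a , to right b) (λ (a , b) → from left a , from right b)
    where
    left = productModel-truth φ s f
    right = productModel-truth ψ s f
  productModel-truth (□I φ) s f = mk⇔
    (λ { h (s' , _) refl → to (productModel-truth φ s' f) (h s') })
    (λ h s' → from (productModel-truth φ s' f) (h (s' , f) refl))
  productModel-truth (□F φ) s f = mk⇔
    (λ { h (_ , f') refl → to (productModel-truth φ s f') (h f') })
    (λ h f' → from (productModel-truth φ s f') (h (s , f') refl))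

theorem1 : (A : Set) → (A ↣ ℕ) → (k : ℕ) → (φ : Form A k) →
    SatMCM φ ⇔ SatMDM φ
theorem1 A inj k φ = mk⇔
  (λ (Γ , s , f , sat) → productModel Γ , (s , f) , to (productModel-truth Γ φ s f) sat)
  (Enumeration.SatMDM⇒SatMCM (Injection.to inj) (Injection.injective inj) φ)
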